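{- Let $V$ be a finite set of truth values with a partial order $\leq$ having $0$ as least and $1$ as greatest element, and let $\models_{\leq}$ be the associated order-theoretic truth-relation (constant expressive semantics). Then every regular connective for $\models_{\leq}$ shares a regularity rule with some classical connective.
   Context: $\gamma\models_{\leq}\delta$ iff ($\exists x\in\gamma,\exists y\in\delta: x\leq y$) or $0\in\gamma$ or $1\in\delta$. Semantics: valuations mapping atoms to $V$, connectives interpreted by fixed truth functions, extended compositionally, every assignment to finitely many distinct atoms realized; constant expressive: every value is the constant value of some formula. $\Gamma\vdash\Delta$ iff $v(\Gamma)\models_{\leq}v(\Delta)$ for all $v$. An $n$-ary connective $C$ is regular with rule $(\mathcal{B}^p,\mathcal{B}^c)$, $\mathcal{B}^p,\mathcal{B}^c\subseteq\mathcal{P}(\{1..n\})^2$, if for all $\Gamma,\Delta,F_1..F_n$: $\Gamma\cup\{C(\vec F)\}\vdash\Delta$ iff for all $(B_p,B_c)\in\mathcal{B}^p$, $\Gamma\cup\{F_i:i\in B_p\}\vdash\{F_i:i\in B_c\}\cup\Delta$; $\Gamma\vdash\{C(\vec F)\}\cup\Delta$ iff the same for all $(B_p,B_c)\in\mathcal{B}^c$. Classical logic: $V=\{0,1\}$ with the relation $\gamma\models\delta$ iff ($\gamma\subseteq\{1\}\Rightarrow 1\in\delta$); classical connectives are truth functions $\{0,1\}^n\to\{0,1\}$. Connectives share a regularity rule if some $(\mathcal{B}^p,\mathcal{B}^c)$ is satisfied by both in their respective logics. -}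

module Defs where

open import Data.Bool using (Bool; true; false)
open import Data.Fin using (Fin)
open import Data.Fin.Properties using (any?)
open import Data.Fin.Subset using (Subset) renaming (_∈_ to _∈ˢ_)
open import Data.List using (List)
open import Data.List.Relation.Unary.All using (All)
open import Data.Nat using (ℕ; _≟_)
open import Data.Product using (_×_; _,_; ∃; ∃-syntax; ∃₂)
open import Data.Sum using (_⊎_)
open import Data.Vec using (Vec; []; _∷_; lookup)
open import Data.Empty using (⊥-elim)
open import Data.Unit using (tt)
open import Function using (id)
open import Function.Bundles using (_⇔_; _↔_)
open import Function.Definitions using (Injective)
open import Level using (0ℓ)
open import Relation.Binary.Core using (Rel)
open import Relation.Binary.Definitions using (Maximum; Minimum)
open import Relation.Binary.PropositionalEquality using (_≡_; _≢_; refl; cong)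
open import Relation.Binary.Structures using (IsPartialOrder)
open import Relation.Nullary using (yes; no)
open import Relation.Unary using (Pred; _∈_; _⊆_; _∪_; ｛_｝; U)

record TruthValues : Set₁ where
  field
    V              : Set
    size           : ℕ
    finite         : Fin size ↔ V
    _≤_            : Rel V 0ℓ
    isPartialOrder : IsPartialOrder _≡_ _≤_
    0# 1#          : V
    minimum        : Minimum _≤_ 0#
    maximum        : Maximum _≤_ 1#
    -- In a one-element order the constantly designated nullary connective
    -- would be regular with the rule (∅ , ∅), which no truth function
    -- on {0,1} has.
    0≢1            : 0# ≢ 1#

record Language : Set₁ where
  field
    Atom : Set
    Conn : ℕ → Set

module _ (L : Language) where
  open Language L

  data Formula : Set where
    atom : Atom → Formula
    app  : ∀ {n} → Conn n → Vec Formula n → Formula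

module _ {L : Language} {V : Set}
         (interp : ∀ {n} → Language.Conn L n → Vec V n → V)
         (v : Language.Atom L → V) where

  -- Mutual, rather than through Vec.map, for the termination checker.
  eval  : Formula L → V
  evals : ∀ {n} → Vec (Formula L) n → Vec V n

  eval (atom p)   = v p
  eval (app c Fs) = interp c (evals Fs)

  evals []       = []
  evals (F ∷ Fs) = eval F ∷ evals Fs

record Semantics (L : Language) (V : Set) : Set₁ where
  open Language L
  field
    interp    : ∀ {n} → Conn n → Vec V n → V
    Valuation : Pred (Atom → V) 0ℓ
    realizes  : ∀ {k} (p : Fin k → Atom) → Injective _≡_ _≡_ p →
                (a : Fin k → V) →
                ∃[ v ] v ∈ Valuation × (∀ i → v (p i) ≡ a i)

ConstantExpressive : ∀ {L V} → Semantics L V → Set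
ConstantExpressive {L} {V} S =
  ∀ (x : V) → ∃[ F ] (∀ v → v ∈ Valuation → eval interp v F ≡ x)
  where open Semantics S

TruthRelation : Set → Set₁
TruthRelation V = Pred V 0ℓ → Pred V 0ℓ → Set

record Logic : Set₁ where
  field
    language  : Language
    Value     : Set
    semantics : Semantics language Value
    _⊨_       : TruthRelation Value

  open Language language public
  open Semantics semantics public

  Form : Set
  Form = Formula language

  -- The direct image v(Γ).
  image : (Atom → Value) → Pred Form 0ℓ → Pred Value 0ℓ
  image v Γ x = ∃[ F ] F ∈ Γ × eval interp v F ≡ x

  infix 4 _⊢_
  _⊢_ : Pred Form 0ℓ → Pred Form 0ℓ → Set
  Γ ⊢ Δ = ∀ v → v ∈ Valuation → image v Γ ⊨ image v Δ

-- A rule (𝓑ᵖ , 𝓑ᶜ); the elements of each 𝓑 ⊆ 𝒫{1..n} × 𝒫{1..n} are listed.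
-- Only membership in the lists matters below.
Rule : ℕ → Set
Rule n = List (Subset n × Subset n) × List (Subset n × Subset n)

module _ (𝓛 : Logic) where
  open Logic 𝓛

  -- { Fᵢ : i ∈ B }
  select : ∀ {n} → Vec Form n → Subset n → Pred Form 0ℓ
  select Fs B G = ∃[ i ] i ∈ˢ B × lookup Fs i ≡ G

  Premises : ∀ {n} → List (Subset n × Subset n) → Vec Form n →
             Pred Form 0ℓ → Pred Form 0ℓ → Set
  Premises 𝓑 Fs Γ Δ =
    All (λ (Bₚ , B꜀) → Γ ∪ select Fs Bₚ ⊢ select Fs B꜀ ∪ Δ) 𝓑

  HasRule : ∀ {n} → Conn n → Rule n → Set₁
  HasRule C (𝓑ᵖ , 𝓑ᶜ) = ∀ Γ Δ Fs →
    ((Γ ∪ ｛ app C Fs ｝ ⊢ Δ) ⇔ Premises 𝓑ᵖ Fs Γ Δ) ×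
    ((Γ ⊢ ｛ app C Fs ｝ ∪ Δ) ⇔ Premises 𝓑ᶜ Fs Γ Δ)

  Regular : ∀ {n} → Conn n → Set₁
  Regular C = ∃[ R ] HasRule C R

SharesRule : ∀ (𝓛 𝓛′ : Logic) {n} → Logic.Conn 𝓛 n → Logic.Conn 𝓛′ n → Set₁
SharesRule 𝓛 𝓛′ C C′ = ∃[ R ] HasRule 𝓛 C R × HasRule 𝓛′ C′ R

module _ (T : TruthValues) where
  open TruthValues T

  OrderTruth : TruthRelation V
  OrderTruth γ δ = (∃₂ λ x y → x ∈ γ × y ∈ δ × x ≤ y) ⊎ 0# ∈ γ ⊎ 1# ∈ δ

  orderLogic : ∀ {L} → Semantics L V → Logic
  orderLogic {L} S = record
    { language = L ; Value = V ; semantics = S ; _⊨_ = OrderTruth }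

ClassicalTruth : TruthRelation Bool
ClassicalTruth γ δ = γ ⊆ ｛ true ｝ → true ∈ δ

-- Countably many atoms, every truth function as a connective denoting itself,
-- and all valuations.
classicalLanguage : Language
classicalLanguage = record { Atom = ℕ ; Conn = λ n → Vec Bool n → Bool }

classicalSemantics : Semantics classicalLanguage Bool
classicalSemantics = record
  { interp    = id
  ; Valuation = U
  ; realizes  = λ p inj a → extend p a , tt , extend-correct p inj a
  }
  where
  extend : ∀ {k} → (Fin k → ℕ) → (Fin k → Bool) → ℕ → Bool
  extend p a m with any? (λ i → p i ≟ m)
  ... | yes (i , _) = a i
  ... | no  _       = false

  extend-correct : ∀ {k} (p : Fin k → ℕ) → Injective _≡_ _≡_ p →
                   (a : Fin k → Bool) → ∀ i → extend p a (p i) ≡ a i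
  extend-correct p inj a i with any? (λ j → p j ≟ p i)
  ... | yes (j , eq) = cong a (inj eq)
  ... | no  none     = ⊥-elim (none (i , refl))

classicalLogic : Logic
classicalLogic = record
  { language = classicalLanguage ; Value = Bool
  ; semantics = classicalSemantics ; _⊨_ = ClassicalTruth }

{-# OPTIONS --safe #-}
-- On formulas whose values are 0 or 1, a premise Γ, {Fᵢ : i ∈ Bₚ} ⊢ {Fᵢ : i ∈ B꜀}, Δ
-- of a rule is valid if some Fᵢ on the left is 0 or some Fᵢ on the right is 1, and
-- otherwise it is equivalent to Γ ⊢ Δ. This holds for ⊨≤ and for classical logic alike.
-- Hence a rule (𝓑ᵖ , 𝓑ᶜ) belongs to a classical connective exactly when, for each
-- Boolean tuple, all premises are refuted in one and only one of 𝓑ᵖ and 𝓑ᶜ. For a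
-- regular connective C of ⊨≤, evaluate the rule on a tuple F of constants 0 and 1. If
-- both sides were refuted, then C(F) ⊢ ∅ and ∅ ⊢ C(F), so that C(F) would be 0 and 1.
-- If neither were, then C(F) ⊢ C(F) would reduce to ∅ ⊢ C(F) and then to ∅ ⊢ ∅.
module Submission where

open import Defs
open import Data.Bool using (Bool; true; false; not)
import Data.Bool as Bool
open import Data.Empty using (⊥-elim)
open import Data.Fin using (Fin; zero; suc)
open import Data.Fin.Properties using (any?)
open import Data.Fin.Subset using (Subset) renaming (_∈_ to _∈ˢ_)
open import Data.Fin.Subset.Properties using (_∈?_)
open import Data.List using (List)
open import Data.List.Relation.Unary.All using (All; all?)
import Data.List.Relation.Unary.All as All
open import Data.List.Relation.Unary.All.Properties using (¬All⇒Any¬)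
open import Data.Nat using (ℕ)
open import Data.Product using (_×_; _,_; ∃; ∃-syntax; proj₁; proj₂)
open import Data.Sum using (_⊎_; inj₁; inj₂; map₁; map₂)
open import Data.Unit using (tt)
open import Data.Vec using (Vec; _∷_; lookup; map)
open import Data.Vec.Properties using (lookup-map)
open import Function using (id; _∘_; case_of_)
open import Function.Bundles using (_⇔_; mk⇔; Equivalence)
open import Level using (0ℓ)
open import Relation.Binary.PropositionalEquality
  using (_≡_; refl; sym; trans; cong; subst)
open import Relation.Binary.Structures using (IsPartialOrder)
open import Relation.Nullary using (¬_; Dec; yes; no)
open import Relation.Nullary.Decidable using (_×-dec_; _⊎-dec_)
open import Relation.Unary using (Pred; _∈_; _∪_; ｛_｝; ∅)

open Equivalence using (to; from)

-- This is the classical truth under `b` of the sequent from `Bₚ` to `B꜀`. What is refuted is the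
-- claim that `Bₚ` is all true and `B꜀` all false.
Refuted : ∀ {n} → Vec Bool n → Subset n × Subset n → Set
Refuted b (Bₚ , B꜀) = (∃[ i ] i ∈ˢ Bₚ × lookup b i ≡ false)
                    ⊎ (∃[ i ] i ∈ˢ B꜀ × lookup b i ≡ true)

refuted? : ∀ {n} (b : Vec Bool n) B → Dec (Refuted b B)
refuted? b (Bₚ , B꜀) =
  any? (λ i → (i ∈? Bₚ) ×-dec (lookup b i Bool.≟ false)) ⊎-dec
  any? (λ i → (i ∈? B꜀) ×-dec (lookup b i Bool.≟ true))

-- These closure properties are what the two truth-relations have in common, so the analysis of
-- rules is done once for both.
record Bivalent {A : Set} (_⊨_ : TruthRelation A) (ι : Bool → A) : Set₁ where
  field
    false-left : ∀ {γ δ} → ι false ∈ γ → γ ⊨ δ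
    true-right : ∀ {γ δ} → ι true ∈ δ → γ ⊨ δ
    -- Weakening, combined with the removal of true premises and false conclusions.
    strip : ∀ {γ δ γ′ δ′} →
            (∀ {x} → x ∈ γ′ → x ∈ γ ⊎ x ≡ ι true) →
            (∀ {x} → x ∈ δ′ → x ≡ ι false ⊎ x ∈ δ) →
            γ′ ⊨ δ′ → γ ⊨ δ

module BivalentRules (𝓛 : Logic) (ι : Bool → Logic.Value 𝓛)
                     (bivalent : Bivalent (Logic._⊨_ 𝓛) ι) where
  open Logic 𝓛
  open Bivalent bivalent

  private
    variable
      n   : ℕ
      v   : Atom → Value
      Γ Δ : Pred Form 0ℓ

  ValuedBy : (Atom → Value) → Vec Form n → Vec Bool n → Set
  ValuedBy v Fs b = ∀ i → eval interp v (lookup Fs i) ≡ ι (lookup b i)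

  image-∪ : ∀ {x} →
            x ∈ image v (Γ ∪ Δ) → x ∈ image v Γ ⊎ x ∈ image v Δ
  image-∪ (F , inj₁ p , e) = inj₁ (F , p , e)
  image-∪ (F , inj₂ p , e) = inj₂ (F , p , e)

  image-∪ˡ : ∀ {x} → x ∈ image v Γ → x ∈ image v (Γ ∪ Δ)
  image-∪ˡ (F , p , e) = F , inj₁ p , e

  image-∪ʳ : ∀ {x} → x ∈ image v Δ → x ∈ image v (Γ ∪ Δ)
  image-∪ʳ (F , p , e) = F , inj₂ p , e

  image-｛｝ : ∀ {F x} → x ∈ image v ｛ F ｝ → x ≡ eval interp v F
  image-｛｝ (_ , refl , e) = sym e

  extend-valid : ∀ {Γ′ Δ′} → image v Γ ⊨ image v Δ →
                 image v (Γ ∪ Γ′) ⊨ image v (Δ′ ∪ Δ)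
  extend-valid = strip (inj₁ ∘ image-∪ˡ) (inj₂ ∘ image-∪ʳ)

  refuted⇒valid : ∀ Fs (b : Vec Bool n) → ValuedBy v Fs b →
                  ∀ {Bₚ B꜀} → Refuted b (Bₚ , B꜀) →
                  image v (Γ ∪ select 𝓛 Fs Bₚ) ⊨ image v (select 𝓛 Fs B꜀ ∪ Δ)
  refuted⇒valid Fs b val (inj₁ (i , i∈Bₚ , bᵢ)) =
    false-left (_ , inj₂ (i , i∈Bₚ , refl) , trans (val i) (cong ι bᵢ))
  refuted⇒valid Fs b val (inj₂ (i , i∈B꜀ , bᵢ)) =
    true-right (_ , inj₁ (i , i∈B꜀ , refl) , trans (val i) (cong ι bᵢ))

  unrefuted⇒reduces : ∀ Fs (b : Vec Bool n) → ValuedBy v Fs b →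
                      ∀ {Bₚ B꜀} → ¬ Refuted b (Bₚ , B꜀) →
                      image v (Γ ∪ select 𝓛 Fs Bₚ) ⊨ image v (select 𝓛 Fs B꜀ ∪ Δ) →
                      image v Γ ⊨ image v Δ
  unrefuted⇒reduces {v = v} Fs b val {Bₚ} {B꜀} ¬refuted =
    strip (map₂ left ∘ image-∪) (map₁ right ∘ image-∪)
    where
    left : ∀ {x} → x ∈ image v (select 𝓛 Fs Bₚ) → x ≡ ι true
    left (_ , (i , i∈Bₚ , refl) , refl) with lookup b i in bᵢ
    ... | true  = trans (val i) (cong ι bᵢ)
    ... | false = ⊥-elim (¬refuted (inj₁ (i , i∈Bₚ , bᵢ)))
    right : ∀ {x} → x ∈ image v (select 𝓛 Fs B꜀) → x ≡ ι false
    right (_ , (i , i∈B꜀ , refl) , refl) with lookup b i in bᵢ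
    ... | false = trans (val i) (cong ι bᵢ)
    ... | true  = ⊥-elim (¬refuted (inj₂ (i , i∈B꜀ , bᵢ)))

  -- The tuple `b` may vary with `v`: classical formulas need this, while tuples of constants use a
  -- fixed `b`.
  premises⇔ : ∀ Fs (b : (Atom → Value) → Vec Bool n) →
              (∀ v → v ∈ Valuation → ValuedBy v Fs (b v)) → ∀ 𝓑 →
              Premises 𝓛 𝓑 Fs Γ Δ ⇔
              (∀ v → v ∈ Valuation → ¬ All (Refuted (b v)) 𝓑 → image v Γ ⊨ image v Δ)
  premises⇔ Fs b val 𝓑 = mk⇔
    (λ premises v v∈ ¬all →
      -- Decidability of `Refuted` turns the negated `All` into an explicit unrefuted pair.
      let valid , ¬refuted = All.lookupAny premises (¬All⇒Any¬ (refuted? (b v)) 𝓑 ¬all)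
      in unrefuted⇒reduces Fs (b v) (val v v∈) ¬refuted (valid v v∈))
    (λ h → All.tabulate λ {B} B∈ v v∈ → case refuted? (b v) B of λ where
      (yes refuted) → refuted⇒valid Fs (b v) (val v v∈) refuted
      (no ¬refuted) → extend-valid {Γ′ = select 𝓛 Fs (proj₁ B)} {Δ′ = select 𝓛 Fs (proj₂ B)}
                        (h v v∈ λ all → ¬refuted (All.lookup all B∈)))

  -- A true premise can be stripped; a false one makes the left side valid and the condition on the
  -- right vacuous. The conditional form matches that of `premises⇔`.
  left⇔ : ∀ {F} c → eval interp v F ≡ ι c →
          (image v (Γ ∪ ｛ F ｝) ⊨ image v Δ) ⇔ (c ≡ true → image v Γ ⊨ image v Δ)
  left⇔ true  e = mk⇔
    (λ h _ → strip (map₂ (λ m → trans (image-｛｝ m) e) ∘ image-∪) inj₂ h)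
    (λ h → strip (inj₁ ∘ image-∪ˡ) inj₂ (h refl))
  left⇔ false e = mk⇔ (λ _ ()) (λ _ → false-left (_ , inj₂ refl , e))

  right⇔ : ∀ {F} c → eval interp v F ≡ ι c →
           (image v Γ ⊨ image v (｛ F ｝ ∪ Δ)) ⇔ (c ≡ false → image v Γ ⊨ image v Δ)
  right⇔ false e = mk⇔
    (λ h _ → strip inj₁ (map₁ (λ m → trans (image-｛｝ m) e) ∘ image-∪) h)
    (λ h → strip inj₁ (inj₂ ∘ image-∪ʳ) (h refl))
  right⇔ true  e = mk⇔ (λ _ ()) (λ _ → true-right (_ , inj₁ refl , e))

classical-bivalent : Bivalent ClassicalTruth id
classical-bivalent = record
  { false-left = λ false∈γ γ⊆true → ⊥-elim (true≢false (γ⊆true false∈γ))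
  ; true-right = λ true∈δ _ → true∈δ
  ; strip      = λ γ′⊆ δ′⊆ h γ⊆true →
      conclude (δ′⊆ (h λ x∈γ′ → premise γ⊆true (γ′⊆ x∈γ′)))
  }
  where
  true≢false : ¬ true ≡ false
  true≢false ()
  conclude : ∀ {P : Set} → true ≡ false ⊎ P → P
  conclude (inj₂ p) = p
  premise : ∀ {γ : Pred Bool 0ℓ} {x} → (∀ {y} → y ∈ γ → true ≡ y) →
            x ∈ γ ⊎ x ≡ true → true ≡ x
  premise γ⊆true (inj₁ x∈γ)  = γ⊆true x∈γ
  premise γ⊆true (inj₂ refl) = refl

evals-lookup : ∀ {L V} (interp : ∀ {n} → Language.Conn L n → Vec V n → V) v
               {n} (Fs : Vec (Formula L) n) i →
               eval interp v (lookup Fs i) ≡ lookup (evals interp v Fs) i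
evals-lookup interp v (F ∷ Fs) zero    = refl
evals-lookup interp v (F ∷ Fs) (suc i) = evals-lookup interp v Fs i

-- At each valuation, both the sequent with the compound formula and the list of premises amount to
-- Γ ⊨ Δ under a condition. The hypotheses identify the two conditions.
classical-hasRule :
  ∀ {n} (f : Vec Bool n → Bool) (𝓑ᵖ 𝓑ᶜ : List (Subset n × Subset n)) →
  (∀ b → f b ≡ true  ⇔ (¬ All (Refuted b) 𝓑ᵖ)) →
  (∀ b → f b ≡ false ⇔ (¬ All (Refuted b) 𝓑ᶜ)) →
  HasRule classicalLogic f (𝓑ᵖ , 𝓑ᶜ)
classical-hasRule {n} f 𝓑ᵖ 𝓑ᶜ f-true f-false Γ Δ Fs =
  mk⇔ (λ h → from (premises 𝓑ᵖ) λ v _ r → to (left⇔ (f (b v)) refl) (h v tt) (from (f-true (b v)) r))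
      (λ h v _ → from (left⇔ (f (b v)) refl) λ e → to (premises 𝓑ᵖ) h v tt (to (f-true (b v)) e)) ,
  mk⇔ (λ h → from (premises 𝓑ᶜ) λ v _ r → to (right⇔ (f (b v)) refl) (h v tt) (from (f-false (b v)) r))
      (λ h v _ → from (right⇔ (f (b v)) refl) λ e → to (premises 𝓑ᶜ) h v tt (to (f-false (b v)) e))
  where
  open BivalentRules classicalLogic id classical-bivalent
  b : (ℕ → Bool) → Vec Bool n
  b v = evals id v Fs
  premises = premises⇔ {Γ = Γ} {Δ = Δ} Fs b (λ v _ → evals-lookup id v Fs)

module _ (T : TruthValues) where
  open TruthValues T
  open IsPartialOrder isPartialOrder using (antisym) renaming (refl to ≤-refl)

  fromBool : Bool → V
  fromBool false = 0#
  fromBool true  = 1#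

  order-bivalent : Bivalent (OrderTruth T) fromBool
  order-bivalent = record
    { false-left = inj₂ ∘ inj₁
    ; true-right = inj₂ ∘ inj₂
    ; strip      = λ γ′⊆ δ′⊆ → λ where
        (inj₁ (x , y , x∈γ′ , y∈δ′ , x≤y)) → related x≤y (γ′⊆ x∈γ′) (δ′⊆ y∈δ′)
        (inj₂ (inj₁ 0∈γ′)) → least (γ′⊆ 0∈γ′)
        (inj₂ (inj₂ 1∈δ′)) → greatest (δ′⊆ 1∈δ′)
    }
    where
    least : ∀ {γ δ} → 0# ∈ γ ⊎ 0# ≡ 1# → OrderTruth T γ δ
    least (inj₁ 0∈γ) = inj₂ (inj₁ 0∈γ)
    least (inj₂ 0≡1) = ⊥-elim (0≢1 0≡1)
    greatest : ∀ {γ δ} → 1# ≡ 0# ⊎ 1# ∈ δ → OrderTruth T γ δ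
    greatest (inj₁ 1≡0) = ⊥-elim (0≢1 (sym 1≡0))
    greatest (inj₂ 1∈δ) = inj₂ (inj₂ 1∈δ)
    -- If `y` is the dropped `0#`, then `x ≤ 0#` forces `x` to be `0#`; dually, `1# ≤ y` forces `y`
    -- to be `1#`. Dropping both would give `1# ≤ 0#`.
    related : ∀ {γ δ x y} → x ≤ y → x ∈ γ ⊎ x ≡ 1# → y ≡ 0# ⊎ y ∈ δ → OrderTruth T γ δ
    related x≤y (inj₁ x∈γ)  (inj₂ y∈δ)  = inj₁ (_ , _ , x∈γ , y∈δ , x≤y)
    related {γ} x≤y (inj₁ x∈γ)  (inj₁ refl) =
      least (inj₁ (subst γ (antisym x≤y (minimum _)) x∈γ))
    related x≤y (inj₂ refl) (inj₁ refl) = ⊥-elim (0≢1 (antisym (minimum _) x≤y))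
    related {δ = δ} x≤y (inj₂ refl) (inj₂ y∈δ)  =
      greatest (inj₂ (subst δ (antisym (maximum _) x≤y) y∈δ))

  module _ {L : Language} (S : Semantics L V) where
    open Semantics S
    open Logic (orderLogic T S) using (Form; _⊢_)

    ⊢-refl : ∀ {Γ Δ : Pred Form 0ℓ} {F} → F ∈ Γ → F ∈ Δ → Γ ⊢ Δ
    ⊢-refl F∈Γ F∈Δ v _ =
      inj₁ (_ , _ , (_ , F∈Γ , refl) , (_ , F∈Δ , refl) , ≤-refl)

    ⊬-empty : ¬ (∅ ⊢ ∅)
    -- Realizing the assignment to no atoms shows that some valuation exists.
    ⊬-empty h with realizes {0} (λ ()) (λ { {()} }) (λ ())
    ... | v , v∈ , _ with h v v∈
    ... | inj₁ (_ , _ , (_ , () , _) , _)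
    ... | inj₂ (inj₁ (_ , () , _))
    ... | inj₂ (inj₂ (_ , () , _))

    -- When one side is empty, a single clause of `OrderTruth` survives, and it fixes the value of
    -- `F`.
    ⊬-both : ∀ F → ∅ ∪ ｛ F ｝ ⊢ ∅ → ¬ (∅ ⊢ ｛ F ｝ ∪ ∅)
    ⊬-both F l r with realizes {0} (λ ()) (λ { {()} }) (λ ())
    ... | v , v∈ , _ = 0≢1 (trans (sym (value-0 (l v v∈))) (value-1 (r v v∈)))
      where
      image = Logic.image (orderLogic T S)
      value-0 : OrderTruth T (image v (∅ ∪ ｛ F ｝)) (image v ∅) → eval interp v F ≡ 0#
      value-0 (inj₁ (_ , _ , _ , (_ , () , _) , _))
      value-0 (inj₂ (inj₁ (_ , inj₂ refl , e))) = e
      value-0 (inj₂ (inj₂ (_ , () , _)))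
      value-1 : OrderTruth T (image v ∅) (image v (｛ F ｝ ∪ ∅)) → eval interp v F ≡ 1#
      value-1 (inj₁ (_ , _ , (_ , () , _) , _))
      value-1 (inj₂ (inj₁ (_ , () , _)))
      value-1 (inj₂ (inj₂ (_ , inj₁ refl , e))) = e

    module _ (constants : ConstantExpressive S) {n} {C : Language.Conn L n}
             {𝓑ᵖ 𝓑ᶜ : List (Subset n × Subset n)}
             (rule : HasRule (orderLogic T S) C (𝓑ᵖ , 𝓑ᶜ)) (b : Vec Bool n) where
      open BivalentRules (orderLogic T S) fromBool order-bivalent

      private
        constant : Bool → Form
        constant = proj₁ ∘ constants ∘ fromBool

        Fs : Vec Form n
        Fs = map constant b

        CF : Form
        CF = app C Fs

        valued : ∀ v → v ∈ Valuation → ValuedBy v Fs b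
        valued v v∈ i = trans (cong (eval interp v) (lookup-map i constant b))
                              (proj₂ (constants _) v v∈)

        all-refuted : ∀ {𝓑 Γ Δ} → All (Refuted b) 𝓑 → Premises (orderLogic T S) 𝓑 Fs Γ Δ
        all-refuted all = from (premises⇔ Fs (λ _ → b) valued _) λ _ _ ¬all → ⊥-elim (¬all all)

        reduce : ∀ {𝓑 Γ Δ} → ¬ All (Refuted b) 𝓑 → Premises (orderLogic T S) 𝓑 Fs Γ Δ → Γ ⊢ Δ
        reduce ¬all h v v∈ = to (premises⇔ Fs (λ _ → b) valued _) h v v∈ ¬all

      not-both-refuted : All (Refuted b) 𝓑ᵖ → ¬ All (Refuted b) 𝓑ᶜ
      not-both-refuted allᵖ allᶜ =
        ⊬-both CF (from (proj₁ (rule ∅ ∅ Fs)) (all-refuted allᵖ))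
                  (from (proj₂ (rule ∅ ∅ Fs)) (all-refuted allᶜ))

      some-refuted : ¬ All (Refuted b) 𝓑ᵖ → ¬ ¬ All (Refuted b) 𝓑ᶜ
      some-refuted ¬allᵖ ¬allᶜ =
        ⊬-empty (reduce ¬allᶜ (to (proj₂ (rule ∅ ∅ Fs)) ⊢CF))
        where
        ⊢CF : ∅ ⊢ ｛ CF ｝ ∪ ∅
        -- The left rule is used with `CF` itself among the conclusions, where its instance is an
        -- identity sequent. An unrefuted pair of `𝓑ᵖ` then leaves `CF` on the right only.
        ⊢CF = reduce ¬allᵖ
          (to (proj₁ (rule ∅ (｛ CF ｝ ∪ ∅) Fs)) (⊢-refl {F = CF} (inj₂ refl) (inj₁ refl)))

theorem6p6 : (T : TruthValues) (L : Language) (S : Semantics L (TruthValues.V T)) →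
    ConstantExpressive S →
    ∀ (n : ℕ) (C : Language.Conn L n) → Regular (orderLogic T S) C →
    ∃ λ (f : Vec Bool n → Bool) → SharesRule (orderLogic T S) classicalLogic C f
theorem6p6 T L S constants n C ((𝓑ᵖ , 𝓑ᶜ) , rule) =
  f , (𝓑ᵖ , 𝓑ᶜ) , rule , classical-hasRule f 𝓑ᵖ 𝓑ᶜ f-true f-false
  where
  -- The truth function is read off `𝓑ᵖ` alone; that `𝓑ᶜ` prescribes the same function is where
  -- regularity of `C` enters.
  f : Vec Bool n → Bool
  f b = not (Dec.does (all? (refuted? b) 𝓑ᵖ))

  f-true : ∀ b → f b ≡ true ⇔ (¬ All (Refuted b) 𝓑ᵖ)
  f-true b with all? (refuted? b) 𝓑ᵖ
  ... | yes all = mk⇔ (λ ()) (λ ¬all → ⊥-elim (¬all all))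
  ... | no ¬all = mk⇔ (λ _ → ¬all) (λ _ → refl)

  f-false : ∀ b → f b ≡ false ⇔ (¬ All (Refuted b) 𝓑ᶜ)
  f-false b with all? (refuted? b) 𝓑ᵖ
  ... | yes all = mk⇔ (λ _ → not-both-refuted T S constants {C = C} rule b all) (λ _ → refl)
  ... | no ¬all = mk⇔ (λ ()) (λ ¬allᶜ → ⊥-elim (some-refuted T S constants {C = C} rule b ¬all ¬allᶜ))
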